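{- (1) There is a one-to-one map from the set of isomorphism classes of countable graphs into the set of isomorphism classes of countable symmetrically indivisible graphs. (2) There is a one-to-one map from the set of isomorphism classes of countable linear orders into the set of isomorphism classes of countable symmetrically indivisible linear orders.
   Context: Graphs are structures in the language with one binary relation symbol $E$ (irreflexive and symmetric), and linear orders are structures in the language $\{<\}$; substructures are induced. A substructure $\mathcal{N}\subseteq\mathcal{M}$ is symmetrically embedded in $\mathcal{M}$ if every automorphism of $\mathcal{N}$ extends to an automorphism of $\mathcal{M}$. A structure $\mathcal{M}$ is symmetrically indivisible if for every colouring of its universe in two colours there is a monochromatic substructure $\mathcal{M}'\subseteq\mathcal{M}$ such that $\mathcal{M}'\cong\mathcal{M}$ and $\mathcal{M}'$ is symmetrically embedded in $\mathcal{M}$. -}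

module Defs where

open import Data.Bool.Base using (Bool)
open import Data.Nat.Base using (ℕ)
open import Data.Product.Base using (Σ; ∃; _×_; _,_; proj₁)
open import Data.Refinement.Base using (Refinement; value)
open import Function.Bundles using (_↔_; _⇔_; _↣_; module Inverse)
open import Function.Properties.Equivalence using (⇔-isEquivalence)
open import Function.Properties.Inverse using (↔-refl; ↔-sym; ↔-trans)
open import Level using (0ℓ; suc; _⊔_)
open import Relation.Binary.Bundles using (Setoid)
open import Relation.Binary.Core using (Rel)
open import Relation.Binary.Definitions using (Irreflexive; Symmetric)
open import Relation.Binary.PropositionalEquality.Core using (_≡_; subst₂)
open import Relation.Binary.Structures using (IsStrictTotalOrder; IsEquivalence)
open import Relation.Unary using (Pred)

-- Structures in a language with a single binary relation symbol, `E` for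
-- graphs and `<` for linear orders.

record Structure : Set₁ where
  field
    Universe : Set
    R        : Rel Universe 0ℓ

open Structure public

infix 4 _≅_

-- Truth of `R` is compared only up to logical equivalence, so `R` need not
-- be proposition-valued.

record _≅_ (M N : Structure) : Set where
  field
    bijection : Universe M ↔ Universe N

  open Inverse bijection public using (to; from)

  field
    preserves : ∀ x y → R M x y ⇔ R N (to x) (to y)

Automorphism : Structure → Set
Automorphism M = M ≅ M

-- The refinement type carries its membership proofs irrelevantly, so that
-- elements of the substructure are equal exactly when their values are.

substructure : (M : Structure) → Pred (Universe M) 0ℓ → Structure
substructure M S = record
  { Universe = Refinement (Universe M) S
  ; R        = λ x y → R M (value x) (value y)
  }

SymmetricallyEmbedded : (M : Structure) → Pred (Universe M) 0ℓ → Set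
SymmetricallyEmbedded M S =
  (φ : Automorphism (substructure M S)) →
  Σ (Automorphism M) λ ψ →
    ∀ x → _≅_.to ψ (value x) ≡ value (_≅_.to φ x)

Monochromatic : {A : Set} → (A → Bool) → Pred A 0ℓ → Set
Monochromatic c S = ∃ λ b → ∀ x → S x → c x ≡ b

SymmetricallyIndivisible : Structure → Set₁
SymmetricallyIndivisible M =
  (c : Universe M → Bool) →
  Σ (Pred (Universe M) 0ℓ) λ S →
    Monochromatic c S × substructure M S ≅ M × SymmetricallyEmbedded M S

-- Finite universes, including the empty one, count as countable.

Countable : Structure → Set
Countable M = Universe M ↣ ℕ

IsGraph : Structure → Set
IsGraph M = Irreflexive _≡_ (R M) × Symmetric (R M)

IsLinearOrder : Structure → Set
IsLinearOrder M = IsStrictTotalOrder _≡_ (R M)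

≅-refl : ∀ {M} → M ≅ M
≅-refl = record
  { bijection = ↔-refl
  ; preserves = λ _ _ → IsEquivalence.refl ⇔-isEquivalence
  }

≅-sym : ∀ {M N} → M ≅ N → N ≅ M
≅-sym {M} {N} f = record
  { bijection = ↔-sym bijection
  ; preserves = λ x y → IsEquivalence.sym ⇔-isEquivalence
      (subst₂ (λ u v → R M (from x) (from y) ⇔ R N u v)
        (strictlyInverseˡ x) (strictlyInverseˡ y)
        (preserves (from x) (from y)))
  }
  where
  open _≅_ f
  open Inverse bijection using (strictlyInverseˡ)

≅-trans : ∀ {M N K} → M ≅ N → N ≅ K → M ≅ K
≅-trans f g = record
  { bijection = ↔-trans (_≅_.bijection f) (_≅_.bijection g)
  ; preserves = λ x y → IsEquivalence.trans ⇔-isEquivalence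
      (_≅_.preserves f x y)
      (_≅_.preserves g (_≅_.to f x) (_≅_.to f y))
  }

-- The set of isomorphism classes of structures satisfying `P`, as a setoid:
-- equality is isomorphism and ignores the proofs of `P`.

IsoClasses : ∀ {ℓ} → Pred Structure ℓ → Setoid (suc 0ℓ ⊔ ℓ) 0ℓ
IsoClasses P = record
  { Carrier       = Σ Structure P
  ; _≈_           = λ M N → proj₁ M ≅ proj₁ N
  ; isEquivalence = record { refl = ≅-refl ; sym = ≅-sym ; trans = ≅-trans }
  }

{-# OPTIONS --safe #-}

-- A countable linear order L is sent to M = ℚ + 2 + L, and a countable graph
-- G to M = Rado ⊔ G. In M the summand ℚ (resp. Rado) is a module, so its
-- automorphisms extend to M by the identity, and it suffices to find in it a
-- monochromatic copy of M whose automorphisms extend to the summand.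
--
-- For orders, Cantor's theorem identifies ℚ with M many copies of ℚ in the
-- order M. If every copy meets the first colour, choose such a point in each
-- copy; otherwise some copy has the second colour only, and the construction
-- is repeated inside it with arbitrary choices.
--
-- For graphs, `FreeGraph X` adds to X, functorially, infinitely many vertices
-- for every finite neighbourhood, so automorphisms of X extend to it. Some
-- colour realises every finite type extending a fixed type (U₀, W₀); let X be
-- the union of M and Rado, where M is joined exactly to U₀. A back-and-forth
-- that fixes U₀ and W₀ identifies `FreeGraph X` with Rado and sends M into
-- that colour.
module Submission where

open import Axiom.ExcludedMiddle using (ExcludedMiddle)
open import Data.Product.Base using (_×_)
open import Function.Bundles using (Injection)
open import Level using (0ℓ)
open import Relation.Unary using (_∩_)
open import Defs

import Algebra.Properties.Group
open import Data.Bool.Base as Bool using (Bool; true; false; if_then_else_)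
open import Data.Bool.Properties as Bool using (¬-not)
open import Data.Empty using (⊥; ⊥-elim)
open import Data.Integer.Base using (ℤ; +_; -[1+_])
open import Data.Irrelevant using ([_])
open import Data.List.Base using (List; []; _∷_; _++_; map; filter; foldr; concatMap)
open import Data.List.Membership.Propositional using (_∈_)
open import Data.List.Membership.Propositional.Properties
  using (∈-map⁺; ∈-map⁻; ∈-map∘filter⁺; ∈-map∘filter⁻; ∈-++⁺ˡ; ∈-++⁺ʳ; ∈-concatMap⁺)
open import Data.List.Relation.Binary.Disjoint.Propositional using (Disjoint)
open import Data.List.Relation.Binary.Subset.Propositional using (_⊆_)
open import Data.List.Relation.Unary.Any as Any using (here; there)
open import Data.Nat.Base as ℕ using (ℕ; zero; suc; _<_; _⊔_; _≤′_; ≤′-refl; ≤′-step; s≤s)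
import Data.Nat.Properties as ℕ
open import Data.Product.Base using (Σ; ∃; _,_; proj₁; proj₂)
open import Data.Rational.Base as ℚ using (ℚ; mkℚ; 0ℚ; 1ℚ)
import Data.Rational.Properties as ℚ
open import Data.Refinement.Base using (Refinement; _,_; value)
open import Data.Refinement.Properties using (value-injective)
open import Data.Sum.Base using (_⊎_; inj₁; inj₂)
open import Data.Sum.Properties using (inj₁-injective; inj₂-injective)
open import Data.Unit.Base using (⊤; tt)
open import Function.Base using (_∘_; id)
open import Function.Bundles using (_⇔_; _↣_; mk⇔; mk↣; mk↔ₛ′; Equivalence; Inverse)
open import Function.Properties.Equivalence using (⇔-isEquivalence)
open import Relation.Binary.Definitions using (Irreflexive; Symmetric; Trichotomous; Transitive; tri<; tri≈; tri>)
open import Relation.Binary.PropositionalEquality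
  using (_≡_; _≢_; refl; sym; trans; cong; cong₂; subst; subst₂; isEquivalence)
open import Relation.Binary.Structures using (IsStrictTotalOrder; IsEquivalence)
open import Relation.Binary.Structures.Biased using (isStrictTotalOrderᶜ)
open import Relation.Nullary.Decidable.Core using (Dec; yes; no; recompute; ¬?)
open import Relation.Nullary.Negation.Core using (¬_; contradiction)

open Equivalence using () renaming (to to ⇒; from to ⇐)
open Injection using () renaming (to to code; injective to code-injective)

private
  module ⇔ = IsEquivalence (⇔-isEquivalence {0ℓ})

mk≅ : ∀ {M N} (to : Universe M → Universe N) (from : Universe N → Universe M) →
      (∀ y → to (from y) ≡ y) → (∀ x → from (to x) ≡ x) →
      (∀ x y → R M x y ⇔ R N (to x) (to y)) → M ≅ N
mk≅ to from to∘from from∘to preserves = record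
  { bijection = mk↔ₛ′ to from to∘from from∘to
  ; preserves = preserves
  }

module Iso {M N : Structure} (φ : M ≅ N) where
  open _≅_ φ public
  open Inverse bijection public using () renaming (strictlyInverseˡ to to∘from; strictlyInverseʳ to from∘to)

  to-injective : ∀ {x y} → to x ≡ to y → x ≡ y
  to-injective {x} {y} eq = trans (sym (from∘to x)) (trans (cong from eq) (from∘to y))

  to-from : ∀ {x y} → to x ≡ y → from y ≡ x
  to-from {x} refl = from∘to x

open Iso using (to; from)

-- Countability

abstract
  -- With `s = a + b` the value lies between the square of `s` and that square plus `s`, short of
  -- the next square. So it determines `s`, and then `a`.
  pair : ℕ → ℕ → ℕ
  pair a b = (a ℕ.+ b) ℕ.* (a ℕ.+ b) ℕ.+ a

  pair-< : ∀ a b a′ b′ → a ℕ.+ b < a′ ℕ.+ b′ → pair a b < pair a′ b′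
  pair-< a b a′ b′ s<s′ = begin-strict
    s ℕ.* s ℕ.+ a       ≤⟨ ℕ.+-monoʳ-≤ (s ℕ.* s) (ℕ.m≤m+n a b) ⟩
    s ℕ.* s ℕ.+ s       ≡⟨ ℕ.+-comm (s ℕ.* s) s ⟩
    s ℕ.+ s ℕ.* s       ≡⟨ ℕ.*-suc s s ⟨
    s ℕ.* suc s         <⟨ ℕ.*-monoˡ-< (suc s) (ℕ.n<1+n s) ⟩
    suc s ℕ.* suc s     ≤⟨ ℕ.*-mono-≤ s<s′ s<s′ ⟩
    s′ ℕ.* s′           ≤⟨ ℕ.m≤m+n (s′ ℕ.* s′) a′ ⟩
    s′ ℕ.* s′ ℕ.+ a′    ∎
    where
    open ℕ.≤-Reasoning
    s s′ : ℕ
    s = a ℕ.+ b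
    s′ = a′ ℕ.+ b′

  pair-injective : ∀ {a b a′ b′} → pair a b ≡ pair a′ b′ → a ≡ a′ × b ≡ b′
  pair-injective {a} {b} {a′} {b′} eq with ℕ.<-cmp (a ℕ.+ b) (a′ ℕ.+ b′)
  ... | tri< s<s′ _ _ = contradiction eq (ℕ.<⇒≢ (pair-< a b a′ b′ s<s′))
  ... | tri> _ _ s>s′ = contradiction (sym eq) (ℕ.<⇒≢ (pair-< a′ b′ a b s>s′))
  ... | tri≈ _ s≡s′ _ = a≡a′ , ℕ.+-cancelˡ-≡ a b b′ (trans s≡s′ (cong (ℕ._+ b′) (sym a≡a′)))
    where
    a≡a′ : a ≡ a′
    a≡a′ = ℕ.+-cancelˡ-≡ _ a a′ (trans eq (cong (λ s → s ℕ.* s ℕ.+ a′) (sym s≡s′)))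

×-countable : {A B : Set} → A ↣ ℕ → B ↣ ℕ → (A × B) ↣ ℕ
×-countable f g = mk↣ {to = λ (a , b) → pair (code f a) (code g b)} λ eq →
  let eq₁ , eq₂ = pair-injective eq in cong₂ _,_ (code-injective f eq₁) (code-injective g eq₂)

⊎-countable : {A B : Set} → A ↣ ℕ → B ↣ ℕ → (A ⊎ B) ↣ ℕ
⊎-countable {A} {B} f g = mk↣ {to = tag} tag-injective
  where
  tag : A ⊎ B → ℕ
  tag (inj₁ a) = pair 0 (code f a)
  tag (inj₂ b) = pair 1 (code g b)

  tag-injective : ∀ {x y} → tag x ≡ tag y → x ≡ y
  tag-injective {inj₁ _} {inj₁ _} eq = cong inj₁ (code-injective f (proj₂ (pair-injective eq)))
  tag-injective {inj₂ _} {inj₂ _} eq = cong inj₂ (code-injective g (proj₂ (pair-injective eq)))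
  tag-injective {inj₁ _} {inj₂ _} eq = contradiction (proj₁ (pair-injective eq)) λ ()
  tag-injective {inj₂ _} {inj₁ _} eq = contradiction (proj₁ (pair-injective eq)) λ ()

ℤ-countable : ℤ ↣ ℕ
ℤ-countable = mk↣ {to = sign} sign-injective
  where
  sign : ℤ → ℕ
  sign (+ n)    = pair 0 n
  sign -[1+ n ] = pair 1 n

  sign-injective : ∀ {x y} → sign x ≡ sign y → x ≡ y
  sign-injective {+ _}      {+ _}      eq = cong +_ (proj₂ (pair-injective eq))
  sign-injective { -[1+ _ ]} { -[1+ _ ]} eq = cong -[1+_] (proj₂ (pair-injective eq))
  sign-injective {+ _}      { -[1+ _ ]} eq = contradiction (proj₁ (pair-injective eq)) λ ()
  sign-injective { -[1+ _ ]} {+ _}      eq = contradiction (proj₁ (pair-injective eq)) λ ()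

ℚ-countable : ℚ ↣ ℕ
ℚ-countable = mk↣ {to = λ q → pair (code ℤ-countable (ℚ.numerator q)) (ℚ.denominator-1 q)} inj
  where
  inj : ∀ {p q} → pair (code ℤ-countable (ℚ.numerator p)) (ℚ.denominator-1 p)
                ≡ pair (code ℤ-countable (ℚ.numerator q)) (ℚ.denominator-1 q) → p ≡ q
  inj {mkℚ n d _} {mkℚ n′ d′ _} eq with pair-injective eq
  ... | eq₁ , refl with code-injective ℤ-countable {n} {n′} eq₁
  ... | refl = refl

-- Symmetric indivisibility

module _ (em : ExcludedMiddle 0ℓ) (M : Structure) where

  -- Symmetric embeddedness is phrased along `embed`: automorphisms of the image correspond to
  -- automorphisms `σ` of `M`, so `extend` has to follow only these.
  record MonochromaticCopy (c : Universe M → Bool) : Set where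
    field
      embed           : Universe M → Universe M
      embed-injective : ∀ {x y} → embed x ≡ embed y → x ≡ y
      preserves       : ∀ x y → R M x y ⇔ R M (embed x) (embed y)
      colour          : Bool
      monochromatic   : ∀ x → c (embed x) ≡ colour
      extend          : (σ : Automorphism M) → Σ (Automorphism M) λ ψ →
                        ∀ x → to ψ (embed x) ≡ embed (to σ x)

  indivisible-from-copies : (∀ c → MonochromaticCopy c) → SymmetricallyIndivisible M
  indivisible-from-copies copies c = Image , (colour , λ { _ (m , refl) → monochromatic m }) , image≅M , symmetric
    where
    open MonochromaticCopy (copies c)

    Image : Universe M → Set
    Image x = ∃ λ m → embed m ≡ x

    preimage : (x : Refinement (Universe M) Image) → Image (value x)
    -- The membership proof `p` is irrelevant; excluded middle decides `Image x` and so restores a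
    -- usable one.
    preimage (x , [ p ]) = recompute em p

    image≅M : substructure M Image ≅ M
    image≅M = mk≅ (λ x → proj₁ (preimage x)) (λ m → embed m , [ (m , refl) ])
      (λ m → embed-injective (proj₂ (preimage (embed m , [ (m , refl) ]))))
      (λ x → value-injective (proj₂ (preimage x)))
      (λ x y → ⇔.sym (subst₂ (λ u v → R M (proj₁ (preimage x)) (proj₁ (preimage y)) ⇔ R M u v)
        (proj₂ (preimage x)) (proj₂ (preimage y)) (preserves _ _)))

    symmetric : SymmetricallyEmbedded M Image
    symmetric φ = proj₁ (extend σ) , λ x →
      trans (cong (to (proj₁ (extend σ))) (sym (proj₂ (preimage x))))
        (trans (proj₂ (extend σ) _)
          (trans (cong (λ y → embed (proj₁ (preimage (to φ y)))) (value-injective (proj₂ (preimage x))))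
            (proj₂ (preimage (to φ x)))))
      where
      σ : Automorphism M
      σ = ≅-trans (≅-sym image≅M) (≅-trans φ image≅M)

-- Sums

-- A relation between a left and a right point depends on the right point alone. This makes `M` a
-- module of the sum.
SumRel : (M N : Structure) (P Q : Universe N → Set) → Universe M ⊎ Universe N → Universe M ⊎ Universe N → Set
SumRel M N P Q (inj₁ x) (inj₁ y) = R M x y
SumRel M N P Q (inj₁ x) (inj₂ y) = P y
SumRel M N P Q (inj₂ x) (inj₁ y) = Q x
SumRel M N P Q (inj₂ x) (inj₂ y) = R N x y

Sum : (M N : Structure) (P Q : Universe N → Set) → Structure
Sum M N P Q = record { Universe = Universe M ⊎ Universe N ; R = SumRel M N P Q }

sum-cong : ∀ {M M′ N N′} {P Q : Universe N → Set} {P′ Q′ : Universe N′ → Set}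
           (φ : M ≅ M′) (ψ : N ≅ N′) →
           (∀ y → P y ⇔ P′ (to ψ y)) → (∀ y → Q y ⇔ Q′ (to ψ y)) →
           Sum M N P Q ≅ Sum M′ N′ P′ Q′
sum-cong {M} {M′} {N} {N′} φ ψ P⇔P′ Q⇔Q′ = mk≅
  (Data.Sum.Base.map (to φ) (to ψ)) (Data.Sum.Base.map (from φ) (from ψ))
  (λ { (inj₁ x) → cong inj₁ (Iso.to∘from φ x) ; (inj₂ y) → cong inj₂ (Iso.to∘from ψ y) })
  (λ { (inj₁ x) → cong inj₁ (Iso.from∘to φ x) ; (inj₂ y) → cong inj₂ (Iso.from∘to ψ y) })
  λ { (inj₁ x) (inj₁ y) → Iso.preserves φ x y
    ; (inj₁ x) (inj₂ y) → P⇔P′ y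
    ; (inj₂ x) (inj₁ y) → Q⇔Q′ x
    ; (inj₂ x) (inj₂ y) → Iso.preserves ψ x y }

extend-left : ∀ {M N} {P Q : Universe N → Set} → Automorphism M → Automorphism (Sum M N P Q)
extend-left {Q = Q} σ = sum-cong σ ≅-refl (λ _ → ⇔.refl) (λ _ → ⇔.refl)

-- Back and forth

module _ (A B : Structure) {I : Set} (f : I → Universe A) (g : I → Universe B) where

  -- The pairs `f i`, `g i` for `i` in `l` form a finite partial isomorphism. Swapping `f` and `g`
  -- exchanges the sides and leaves the list as it is.
  Compatible : List I → Set
  Compatible l = ∀ {i j} → i ∈ l → j ∈ l →
    (f i ≡ f j ⇔ g i ≡ g j) × (R A (f i) (f j) ⇔ R B (g i) (g j))

  Fits : List I → Universe A → Universe B → Set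
  Fits l a b = ∀ {i} → i ∈ l → b ≢ g i ×
    (R A a (f i) ⇔ R B b (g i)) × (R A (f i) a ⇔ R B (g i) b)

  Fresh : List I → Universe A → Set
  Fresh l a = ∀ {i} → i ∈ l → a ≢ f i

module _ {A B : Structure} {I : Set} {f : I → Universe A} {g : I → Universe B} where

  compatible-sym : ∀ {l} → Compatible A B f g l → Compatible B A g f l
  compatible-sym comp i∈l j∈l = let eq , rel = comp i∈l j∈l in ⇔.sym eq , ⇔.sym rel

  compatible-⊆ : ∀ {l l′} → l′ ⊆ l → Compatible A B f g l → Compatible A B f g l′
  compatible-⊆ l′⊆l comp i∈l′ j∈l′ = comp (l′⊆l i∈l′) (l′⊆l j∈l′)

  compatible-∷ : Irreflexive _≡_ (R A) → Irreflexive _≡_ (R B) →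
    ∀ {l i} → Compatible A B f g l → Fresh A B f g l (f i) → Fits A B f g l (f i) (g i) →
    Compatible A B f g (i ∷ l)
  compatible-∷ irrA irrB comp fresh fits (here refl) (here refl) =
    mk⇔ (λ _ → refl) (λ _ → refl) ,
    mk⇔ (λ r → contradiction r (irrA refl)) (λ r → contradiction r (irrB refl))
  compatible-∷ irrA irrB comp fresh fits (here refl) (there j∈l) =
    let g≢ , rel , _ = fits j∈l in
    mk⇔ (λ eq → contradiction eq (fresh j∈l)) (λ eq → contradiction eq g≢) , rel
  compatible-∷ irrA irrB comp fresh fits (there i∈l) (here refl) =
    let g≢ , _ , rel = fits i∈l in
    mk⇔ (λ eq → contradiction (sym eq) (fresh i∈l)) (λ eq → contradiction (sym eq) g≢) , rel
  compatible-∷ irrA irrB comp fresh fits (there i∈l) (there j∈l) = comp i∈l j∈l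

∈⇒∷-⊆ : {A : Set} {x : A} {l : List A} → x ∈ l → (x ∷ l) ⊆ l
∈⇒∷-⊆ x∈l (here refl) = x∈l
∈⇒∷-⊆ x∈l (there y∈l) = y∈l

occurs? : ExcludedMiddle 0ℓ → {A I : Set} (f : I → A) (l : List I) (a : A) →
          (∃ λ i → i ∈ l × a ≡ f i) ⊎ (∀ {i} → i ∈ l → a ≢ f i)
occurs? em f l a with em {∃ λ i → i ∈ l × a ≡ f i}
... | yes found = inj₁ found
... | no  none  = inj₂ λ i∈l eq → none (_ , i∈l , eq)

-- `Good` may demand more than compatibility, and `start` may prescribe pairs: the graph case also
-- tracks colours and keeps finitely many vertices fixed.
module BackAndForth
  (em : ExcludedMiddle 0ℓ) {A B : Structure} (cA : Countable A) (cB : Countable B)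
  (Good : List (Universe A × Universe B) → Set)
  (compatible : ∀ {l} → Good l → Compatible A B proj₁ proj₂ l)
  (forth : ∀ {l} → Good l → ∀ a → ∃ λ b → Good ((a , b) ∷ l))
  (back : ∀ {l} → Good l → ∀ b → ∃ λ a → Good ((a , b) ∷ l))
  (start : ∃ Good) where

  Stage : Set
  Stage = ∃ Good

  addLeft addRight : ℕ → Stage → Stage
  addLeft n (l , good) with em {∃ λ a → code cA a ≡ n}
  ... | yes (a , _) = let b , good′ = forth good a in (a , b) ∷ l , good′
  -- Codes need not exhaust ℕ, so a stage may have nothing to add.
  ... | no _        = l , good
  addRight n (l , good) with em {∃ λ b → code cB b ≡ n}
  ... | yes (b , _) = let a , good′ = back good b in (a , b) ∷ l , good′
  ... | no _        = l , good

  stage : ℕ → Stage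
  stage zero    = start
  stage (suc n) = addRight n (addLeft n (stage n))

  addLeft-⊆ : ∀ n s → proj₁ s ⊆ proj₁ (addLeft n s)
  addLeft-⊆ n (l , good) p∈l with em {∃ λ a → code cA a ≡ n}
  ... | yes _ = there p∈l
  ... | no _  = p∈l

  addRight-⊆ : ∀ n s → proj₁ s ⊆ proj₁ (addRight n s)
  addRight-⊆ n (l , good) p∈l with em {∃ λ b → code cB b ≡ n}
  ... | yes _ = there p∈l
  ... | no _  = p∈l

  addLeft-hits : ∀ a s → ∃ λ b → (a , b) ∈ proj₁ (addLeft (code cA a) s)
  addLeft-hits a (l , good) with em {∃ λ a′ → code cA a′ ≡ code cA a}
  ... | no none = contradiction (a , refl) none
  ... | yes (a′ , eq) with code-injective cA eq
  ... | refl = _ , here refl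

  addRight-hits : ∀ b s → ∃ λ a → (a , b) ∈ proj₁ (addRight (code cB b) s)
  addRight-hits b (l , good) with em {∃ λ b′ → code cB b′ ≡ code cB b}
  ... | no none = contradiction (b , refl) none
  ... | yes (b′ , eq) with code-injective cB eq
  ... | refl = _ , here refl

  stage-mono : ∀ {m n} → m ≤′ n → proj₁ (stage m) ⊆ proj₁ (stage n)
  stage-mono ≤′-refl p∈l = p∈l
  stage-mono (≤′-step {n = n} m≤n) p∈l =
    addRight-⊆ n (addLeft n (stage n)) (addLeft-⊆ n (stage n) (stage-mono m≤n p∈l))

  Linked : Universe A → Universe B → Set
  Linked a b = ∃ λ n → (a , b) ∈ proj₁ (stage n)

  linked-left : ∀ a → ∃ (Linked a)
  linked-left a = let n = code cA a ; b , p = addLeft-hits a (stage n) in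
    b , suc n , addRight-⊆ n (addLeft n (stage n)) p

  linked-right : ∀ b → ∃ λ a → Linked a b
  linked-right b = let n = code cB b ; a , p = addRight-hits b (addLeft n (stage n)) in a , suc n , p

  -- Stages increase, so two links occur together in the later stage, which is compatible.
  linked-compatible : ∀ {a b a′ b′} → Linked a b → Linked a′ b′ →
    (a ≡ a′ ⇔ b ≡ b′) × (R A a a′ ⇔ R B b b′)
  linked-compatible (m , p) (n , q) = compatible (proj₂ (stage (m ⊔ n)))
    (stage-mono (ℕ.≤⇒≤′ (ℕ.m≤m⊔n m n)) p) (stage-mono (ℕ.≤⇒≤′ (ℕ.m≤n⊔m m n)) q)

  isomorphism : A ≅ B
  isomorphism = mk≅ (λ a → proj₁ (linked-left a)) (λ b → proj₁ (linked-right b))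
    (λ b → ⇒ (proj₁ (linked-compatible (proj₂ (linked-left _)) (proj₂ (linked-right b)))) refl)
    (λ a → ⇐ (proj₁ (linked-compatible (proj₂ (linked-right _)) (proj₂ (linked-left a)))) refl)
    (λ a a′ → proj₂ (linked-compatible (proj₂ (linked-left a)) (proj₂ (linked-left a′))))

  -- Carries what `Good` says of listed pairs over to the finished isomorphism.
  isomorphism-good : ∀ a → ∃ λ l → Good l × (a , to isomorphism a) ∈ l
  isomorphism-good a = let n , p = proj₂ (linked-left a) in proj₁ (stage n) , proj₂ (stage n) , p

-- Linear orders

record IsDenseUnbounded (A : Structure) : Set where
  field
    point : Universe A
    dense : ∀ {x y} → R A x y → ∃ λ z → R A x z × R A z y
    above : ∀ x → ∃ λ y → R A x y
    below : ∀ y → ∃ λ x → R A x y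

ℚ-order : Structure
ℚ-order = record { Universe = ℚ ; R = ℚ._<_ }

private
  module ℚ< = IsStrictTotalOrder ℚ.<-isStrictTotalOrder
  module ℚ+ = Algebra.Properties.Group ℚ.+-0-group

q<q+1 : ∀ q → q ℚ.< q ℚ.+ 1ℚ
q<q+1 q = subst (ℚ._< q ℚ.+ 1ℚ) (ℚ.+-identityʳ q) (ℚ.+-monoʳ-< q (ℚ.positive⁻¹ 1ℚ))

ℚ-denseUnbounded : IsDenseUnbounded ℚ-order
ℚ-denseUnbounded = record
  { point = 0ℚ
  ; dense = ℚ.<-dense
  ; above = λ q → q ℚ.+ 1ℚ , q<q+1 q
  ; below = λ q → q ℚ.- 1ℚ , subst (q ℚ.- 1ℚ ℚ.<_) (ℚ+.//-rightDividesˡ 1ℚ q) (q<q+1 (q ℚ.- 1ℚ))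
  }

shift-cancel : ∀ t q → q ℚ.+ t ℚ.- t ≡ q
shift-cancel t q = ℚ+.//-rightDividesʳ t q

unshift-cancel : ∀ t q → q ℚ.- t ℚ.+ t ≡ q
unshift-cancel t q = ℚ+.//-rightDividesˡ t q

translation : ℚ → Automorphism ℚ-order
translation t = mk≅ (ℚ._+ t) (ℚ._- t) (unshift-cancel t) (shift-cancel t) λ p q →
  mk⇔ (ℚ.+-monoˡ-< t) λ p+t<q+t →
    subst₂ ℚ._<_ (shift-cancel t p) (shift-cancel t q) (ℚ.+-monoˡ-< (ℚ.- t) p+t<q+t)

-- Cantor's theorem

module Between {A : Structure} (lin : IsLinearOrder A) (du : IsDenseUnbounded A) where
  open IsStrictTotalOrder lin using (compare) renaming (trans to <-trans)
  open IsDenseUnbounded du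

  Below : Universe A → List (Universe A) → Set
  Below z W = ∀ {w} → w ∈ W → R A z w

  below-all : ∀ W → ∃ λ z → Below z W
  below-all [] = point , λ ()
  below-all (w ∷ W) with below-all W
  ... | z , z<W with compare z w
  ... | tri< z<w _ _ = z , λ { (here refl) → z<w ; (there p) → z<W p }
  ... | tri≈ _ refl _ = let y , y<w = below w in
    y , λ { (here refl) → y<w ; (there p) → <-trans y<w (z<W p) }
  ... | tri> _ _ w<z = let y , y<w = below w in
    y , λ { (here refl) → y<w ; (there p) → <-trans (<-trans y<w w<z) (z<W p) }

  -- Induction on `W`. If the point `z` for the remaining bounds is not below `w`, density gives a
  -- point between `x` and `w`; as `w` is at most `z`, it is below the remaining bounds too.
  just-above : ∀ x W → Below x W → ∃ λ z → R A x z × Below z W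
  just-above x [] x<W = let z , x<z = above x in z , x<z , λ ()
  just-above x (w ∷ W) x<W with just-above x W (x<W ∘ there)
  ... | z , x<z , z<W with compare z w
  ... | tri< z<w _ _ = z , x<z , λ { (here refl) → z<w ; (there p) → z<W p }
  ... | tri≈ _ refl _ = let y , x<y , y<w = dense (x<W (here refl)) in
    y , x<y , λ { (here refl) → y<w ; (there p) → <-trans y<w (z<W p) }
  ... | tri> _ _ w<z = let y , x<y , y<w = dense (x<W (here refl)) in
    y , x<y , λ { (here refl) → y<w ; (there p) → <-trans (<-trans y<w w<z) (z<W p) }

  -- Induction on `U`: a point that is not above the new `u` is replaced by one just above `u`,
  -- which exceeds the other lower bounds by transitivity.
  between : ∀ U W → (∀ {u} → u ∈ U → Below u W) → ∃ λ z → (∀ {u} → u ∈ U → R A u z) × Below z W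
  between [] W U<W = let z , z<W = below-all W in z , (λ ()) , z<W
  between (u ∷ U) W U<W with between U W (U<W ∘ there)
  ... | z , U<z , z<W with compare u z
  ... | tri< u<z _ _ = z , (λ { (here refl) → u<z ; (there p) → U<z p }) , z<W
  ... | tri≈ _ refl _ = let y , u<y , y<W = just-above u W (U<W (here refl)) in
    y , (λ { (here refl) → u<y ; (there p) → <-trans (U<z p) u<y }) , y<W
  ... | tri> _ _ z<u = let y , u<y , y<W = just-above u W (U<W (here refl)) in
    y , (λ { (here refl) → u<y ; (there p) → <-trans (<-trans (U<z p) z<u) u<y }) , y<W

module _ {A B : Structure} (linA : IsLinearOrder A) (linB : IsLinearOrder B) (du : IsDenseUnbounded B) where
  private
    module A = IsStrictTotalOrder linA
    module B = IsStrictTotalOrder linB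
  open Between linB du

  -- By compatibility the partners of the points below `a` lie below the partners of the points
  -- above `a`, so some `z` of `B` separates the two finite sets.
  fit-order : ∀ {I : Set} (f : I → Universe A) (g : I → Universe B) l → Compatible A B f g l →
              ∀ a → Fresh A B f g l a → ∃ (Fits A B f g l a)
  fit-order {I} f g l comp a fresh = z , λ i∈l → z-fits i∈l (A.compare a (f _))
    where
    lower? : ∀ i → Dec (R A (f i) a)
    lower? i = f i A.<? a

    upper? : ∀ i → Dec (R A a (f i))
    upper? i = a A.<? f i

    lower<upper : ∀ {u} → u ∈ map g (filter lower? l) → Below u (map g (filter upper? l))
    lower<upper u∈ w∈ with ∈-map∘filter⁻ g lower? u∈ | ∈-map∘filter⁻ g upper? w∈
    ... | i , i∈l , refl , fi<a | j , j∈l , refl , a<fj = ⇒ (proj₂ (comp i∈l j∈l)) (A.trans fi<a a<fj)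

    separated : ∃ λ z → (∀ {u} → u ∈ map g (filter lower? l) → R B u z) × Below z (map g (filter upper? l))
    separated = between _ _ lower<upper

    z : Universe B
    z = proj₁ separated

    lower<z : ∀ {i} → i ∈ l → R A (f i) a → R B (g i) z
    lower<z i∈l fi<a = proj₁ (proj₂ separated) (∈-map∘filter⁺ g lower? (_ , i∈l , refl , fi<a))

    z<upper : ∀ {i} → i ∈ l → R A a (f i) → R B z (g i)
    z<upper i∈l a<fi = proj₂ (proj₂ separated) (∈-map∘filter⁺ g upper? (_ , i∈l , refl , a<fi))

    z-fits : ∀ {i} → i ∈ l → _ → z ≢ g i × (R A a (f i) ⇔ R B z (g i)) × (R A (f i) a ⇔ R B (g i) z)
    z-fits i∈l (tri≈ _ eq _) = contradiction eq (fresh i∈l)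
    z-fits i∈l (tri< a<f _ f≮a) = let z<g = z<upper i∈l a<f in
      (λ eq → B.irrefl eq z<g) , mk⇔ (λ _ → z<g) (λ _ → a<f) ,
      mk⇔ (λ f<a → contradiction f<a f≮a) (λ g<z → contradiction z<g (B.asym g<z))
    z-fits i∈l (tri> a≮f _ f<a) = let g<z = lower<z i∈l f<a in
      (λ eq → B.irrefl (sym eq) g<z) ,
      mk⇔ (λ a<f → contradiction a<f a≮f) (λ z<g → contradiction z<g (B.asym g<z)) ,
      mk⇔ (λ _ → g<z) (λ _ → f<a)

cantor : ExcludedMiddle 0ℓ → ∀ {A B} → Countable A → Countable B → IsLinearOrder A → IsLinearOrder B →
         IsDenseUnbounded A → IsDenseUnbounded B → A ≅ B
cantor em {A} {B} cA cB linA linB duA duB =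
  BackAndForth.isomorphism em cA cB (Compatible A B proj₁ proj₂) id forth back ([] , λ ())
  where
  module A = IsStrictTotalOrder linA
  module B = IsStrictTotalOrder linB

  forth : ∀ {l} → Compatible A B proj₁ proj₂ l → ∀ a → ∃ λ b → Compatible A B proj₁ proj₂ ((a , b) ∷ l)
  forth {l} comp a with occurs? em proj₁ l a
  ... | inj₁ ((_ , b) , p∈l , refl) = b , compatible-⊆ {A} {B} (∈⇒∷-⊆ p∈l) comp
  ... | inj₂ fresh = let b , fits = fit-order linA linB duB proj₁ proj₂ l comp a fresh in
    b , compatible-∷ {A} {B} A.irrefl B.irrefl comp fresh fits

  back : ∀ {l} → Compatible A B proj₁ proj₂ l → ∀ b → ∃ λ a → Compatible A B proj₁ proj₂ ((a , b) ∷ l)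
  back {l} comp b with occurs? em proj₂ l b
  ... | inj₁ ((a , _) , p∈l , refl) = a , compatible-⊆ {A} {B} (∈⇒∷-⊆ p∈l) comp
  ... | inj₂ fresh = let comp′ = compatible-sym {A} {B} comp
                         a , fits = fit-order linB linA duA proj₂ proj₁ l comp′ b fresh in
    a , compatible-sym {B} {A} (compatible-∷ {B} {A} B.irrefl A.irrefl comp′ fresh fits)

-- Sums and lexicographic products of orders

infixr 6 _⊕_
infixr 7 _⊗_

_⊕_ : Structure → Structure → Structure
M ⊕ N = Sum M N (λ _ → ⊤) (λ _ → ⊥)

⊕-linear : ∀ {M N} → IsLinearOrder M → IsLinearOrder N → IsLinearOrder (M ⊕ N)
⊕-linear {M} {N} linM linN = isStrictTotalOrderᶜ (record
  { isEquivalence = isEquivalence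
  ; trans = λ {x} {y} {z} → <-trans x y z
  ; compare = compare
  })
  where
  module M = IsStrictTotalOrder linM
  module N = IsStrictTotalOrder linN

  <-trans : ∀ x y z → R (M ⊕ N) x y → R (M ⊕ N) y z → R (M ⊕ N) x z
  <-trans (inj₁ x) (inj₁ y) (inj₁ z) p q = M.trans p q
  <-trans (inj₁ x) (inj₁ y) (inj₂ z) p q = tt
  <-trans (inj₁ x) (inj₂ y) (inj₂ z) p q = tt
  <-trans (inj₂ x) (inj₂ y) (inj₂ z) p q = N.trans p q

  compare : Trichotomous _≡_ (R (M ⊕ N))
  compare (inj₁ x) (inj₂ y) = tri< tt (λ ()) (λ ())
  compare (inj₂ x) (inj₁ y) = tri> (λ ()) (λ ()) tt
  compare (inj₁ x) (inj₁ y) with M.compare x y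
  ... | tri< p q r = tri< p (q ∘ inj₁-injective) r
  ... | tri≈ p q r = tri≈ p (cong inj₁ q) r
  ... | tri> p q r = tri> p (q ∘ inj₁-injective) r
  compare (inj₂ x) (inj₂ y) with N.compare x y
  ... | tri< p q r = tri< p (q ∘ inj₂-injective) r
  ... | tri≈ p q r = tri≈ p (cong inj₂ q) r
  ... | tri> p q r = tri> p (q ∘ inj₂-injective) r

_⊗_ : Structure → Structure → Structure
M ⊗ N = record
  { Universe = Universe M × Universe N
  ; R        = λ (a , x) (b , y) → R M a b ⊎ (a ≡ b × R N x y)
  }

⊗-linear : ∀ {M N} → IsLinearOrder M → IsLinearOrder N → IsLinearOrder (M ⊗ N)
⊗-linear {M} {N} linM linN = isStrictTotalOrderᶜ (record
  { isEquivalence = isEquivalence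
  ; trans = <-trans
  ; compare = compare
  })
  where
  module M = IsStrictTotalOrder linM
  module N = IsStrictTotalOrder linN

  <-trans : Transitive (R (M ⊗ N))
  <-trans (inj₁ p) (inj₁ q) = inj₁ (M.trans p q)
  <-trans (inj₁ p) (inj₂ (refl , q)) = inj₁ p
  <-trans (inj₂ (refl , p)) (inj₁ q) = inj₁ q
  <-trans (inj₂ (refl , p)) (inj₂ (refl , q)) = inj₂ (refl , N.trans p q)

  compare : Trichotomous _≡_ (R (M ⊗ N))
  compare (a , x) (b , y) with M.compare a b
  ... | tri< p q r = tri< (inj₁ p) (λ { refl → q refl }) λ { (inj₁ p′) → r p′ ; (inj₂ (refl , _)) → q refl }
  ... | tri> p q r = tri> (λ { (inj₁ p′) → p p′ ; (inj₂ (refl , _)) → q refl }) (λ { refl → q refl }) (inj₁ r)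
  ... | tri≈ a≮a refl _ with N.compare x y
  ... | tri< p q r = tri< (inj₂ (refl , p)) (λ { refl → q refl }) λ { (inj₁ p′) → a≮a p′ ; (inj₂ (_ , p′)) → r p′ }
  ... | tri≈ p refl r = tri≈ (λ { (inj₁ p′) → a≮a p′ ; (inj₂ (_ , p′)) → p p′ }) refl
                             (λ { (inj₁ p′) → a≮a p′ ; (inj₂ (_ , p′)) → r p′ })
  ... | tri> p q r = tri> (λ { (inj₁ p′) → a≮a p′ ; (inj₂ (_ , p′)) → p p′ }) (λ { refl → q refl }) (inj₂ (refl , r))

-- The required points are found in the fibre of a given point: even for `a < b`, a point higher in
-- the fibre of `a` lies in between.
⊗-denseUnbounded : ∀ {M N} → Universe M → IsDenseUnbounded N → IsDenseUnbounded (M ⊗ N)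
⊗-denseUnbounded m du = record
  { point = m , point
  ; dense = λ { {a , x} (inj₁ a<b) → let y , x<y = above x in (a , y) , inj₂ (refl , x<y) , inj₁ a<b
              ; {a , x} (inj₂ (refl , x<y)) → let z , x<z , z<y = dense x<y in
                  (a , z) , inj₂ (refl , x<z) , inj₂ (refl , z<y) }
  ; above = λ (a , x) → let y , x<y = above x in (a , y) , inj₂ (refl , x<y)
  ; below = λ (a , x) → let y , y<x = below x in (a , y) , inj₂ (refl , y<x)
  }
  where open IsDenseUnbounded du

-- `ρ m` acts within the fibre over `m`, then `τ` moves whole fibres. All fibres are copies of the
-- same `N`, so `ρ` can vary freely with `m`.
⊗-automorphism : ∀ {M N} → Automorphism M → (Universe M → Automorphism N) → Automorphism (M ⊗ N)
⊗-automorphism {M} {N} τ ρ = mk≅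
  (λ (m , n) → to τ m , to (ρ m) n)
  (λ (m , n) → from τ m , from (ρ (from τ m)) n)
  (λ (m , n) → cong₂ _,_ (Iso.to∘from τ m) (Iso.to∘from (ρ (from τ m)) n))
  (λ (m , n) → trans (cong (λ m′ → m′ , from (ρ m′) (to (ρ m) n)) (Iso.from∘to τ m))
                     (cong (m ,_) (Iso.from∘to (ρ m) n)))
  λ (m , n) (m′ , n′) → mk⇔
    (λ { (inj₁ p) → inj₁ (⇒ (Iso.preserves τ m m′) p)
       ; (inj₂ (refl , q)) → inj₂ (refl , ⇒ (Iso.preserves (ρ m) n n′) q) })
    (λ { (inj₁ p) → inj₁ (⇐ (Iso.preserves τ m m′) p)
       ; (inj₂ (eq , q)) → unshuffle m′ n n′ (Iso.to-injective τ eq) q })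
  where
  unshuffle : ∀ {m} m′ n n′ → m ≡ m′ → R N (to (ρ m) n) (to (ρ m′) n′) → R (M ⊗ N) (m , n) (m′ , n′)
  unshuffle {m} _ n n′ refl q = inj₂ (refl , ⇐ (Iso.preserves (ρ m) n n′) q)

-- θ splits ℚ into copies of ℚ indexed by M. A choice of one point in each of
-- them is symmetrically embedded because translations of ℚ move any chosen
-- point to any other.
module _ (em : ExcludedMiddle 0ℓ) {N : Structure} (cN : Countable N) (linN : IsLinearOrder N) where
  private
    M : Structure
    M = ℚ-order ⊕ N

  ℚ⊕-countable : Countable M
  ℚ⊕-countable = ⊎-countable ℚ-countable cN

  ℚ⊕-linear : IsLinearOrder M
  ℚ⊕-linear = ⊕-linear ℚ.<-isStrictTotalOrder linN

  private
    module M = IsStrictTotalOrder ℚ⊕-linear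

    θ : M ⊗ ℚ-order ≅ ℚ-order
    θ = cantor em (×-countable ℚ⊕-countable ℚ-countable) ℚ-countable
          (⊗-linear ℚ⊕-linear ℚ.<-isStrictTotalOrder) ℚ.<-isStrictTotalOrder
          (⊗-denseUnbounded {M} (inj₁ 0ℚ) ℚ-denseUnbounded) ℚ-denseUnbounded

    conjugate : Automorphism (M ⊗ ℚ-order) → Automorphism M
    conjugate α = extend-left {ℚ-order} {N} (≅-trans (≅-sym θ) (≅-trans α θ))

    conjugate-θ : ∀ α x → to (conjugate α) (inj₁ (to θ x)) ≡ inj₁ (to θ (to α x))
    conjugate-θ α x = cong (λ y → inj₁ (to θ (to α y))) (Iso.from∘to θ x)

  -- `f` picks one point per fibre, and `j` says where the fibres are taken: in the summand ℚ
  -- itself, or in a single fibre, again a copy of ℚ.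
  section-copy : (c : Universe M → Bool) (j : ℚ → Universe M) →
    (∀ {p q} → j p ≡ j q → p ≡ q) → (∀ p q → p ℚ.< q ⇔ R M (j p) (j q)) →
    ((σ : Automorphism ℚ-order) → Σ (Automorphism M) λ ψ → ∀ q → to ψ (j q) ≡ j (to σ q)) →
    (f : Universe M → ℚ) (colour : Bool) → (∀ m → c (j (to θ (m , f m))) ≡ colour) →
    MonochromaticCopy em M c
  section-copy c j j-injective j-preserves j-extend f colour mono = record
    { embed = λ m → j (to θ (m , f m))
    ; embed-injective = λ eq → cong proj₁ (Iso.to-injective θ (j-injective eq))
    -- A fibre contains a single chosen point, so chosen points are compared by their fibres.
    ; preserves = λ m m′ → ⇔.trans (mk⇔ inj₁ λ { (inj₁ p) → p ; (inj₂ (refl , p)) → contradiction p (ℚ<.irrefl refl) })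
        (⇔.trans (Iso.preserves θ (m , f m) (m′ , f m′)) (j-preserves _ _))
    ; colour = colour
    ; monochromatic = mono
    ; extend = λ σ → let ψ , ψ-j = j-extend (≅-trans (≅-sym θ) (≅-trans (lift σ) θ)) in
        ψ , λ m → trans (ψ-j _) (trans (cong (λ y → j (to θ (to (lift σ) y))) (Iso.from∘to θ (m , f m)))
          (cong (λ q → j (to θ (to σ m , q))) (moves σ m)))
    }
    where
    lift : Automorphism M → Automorphism (M ⊗ ℚ-order)
    lift σ = ⊗-automorphism σ λ m → translation (f (to σ m) ℚ.- f m)

    moves : ∀ σ m → f m ℚ.+ (f (to σ m) ℚ.- f m) ≡ f (to σ m)
    moves σ m = trans (ℚ.+-comm (f m) _) (unshift-cancel (f m) (f (to σ m)))

  -- `σ` acts on the fibre over `m`, and all other fibres stay fixed.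
  fibre-extend : ∀ m → (σ : Automorphism ℚ-order) →
    Σ (Automorphism M) λ ψ → ∀ q → to ψ (inj₁ (to θ (m , q))) ≡ inj₁ (to θ (m , to σ q))
  fibre-extend m σ = conjugate α , λ q → trans (conjugate-θ α (m , q)) (cong (λ y → inj₁ (to θ (m , y))) (acts q))
    where
    ρ : Universe M → Automorphism ℚ-order
    ρ m′ with m M.≟ m′
    ... | yes _ = σ
    ... | no _  = ≅-refl

    α : Automorphism (M ⊗ ℚ-order)
    α = ⊗-automorphism ≅-refl ρ

    acts : ∀ q → to (ρ m) q ≡ to σ q
    acts q with m M.≟ m
    ... | yes _  = refl
    ... | no m≢m = contradiction refl m≢m

  ℚ⊕-indivisible : SymmetricallyIndivisible M
  ℚ⊕-indivisible = indivisible-from-copies em M copy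
    where
    copy : ∀ c → MonochromaticCopy em M c
    copy c with em {∃ λ m → ∀ q → c (inj₁ (to θ (m , q))) ≢ true}
    -- The fibre over `m` is entirely of colour `false` and is split by `θ` once more; `0ℚ` is an
    -- arbitrary choice of points.
    ... | yes (m , never) = section-copy c (λ q → inj₁ (to θ (m , q)))
      (λ eq → cong proj₂ (Iso.to-injective θ (inj₁-injective eq)))
      (λ p q → ⇔.trans (mk⇔ (λ r → inj₂ (refl , r))
                 λ { (inj₁ r) → contradiction r (M.irrefl {m} refl) ; (inj₂ (_ , r)) → r })
               (Iso.preserves θ (m , p) (m , q)))
      (fibre-extend m) (λ _ → 0ℚ) false (λ m′ → ¬-not (never (to θ (m′ , 0ℚ))))
    ... | no somewhere = section-copy c inj₁ inj₁-injective (λ _ _ → ⇔.refl)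
      (λ σ → extend-left σ , λ _ → refl) (λ m → proj₁ (hits m)) true (λ m → proj₂ (hits m))
      where
      hits : ∀ m → ∃ λ q → c (inj₁ (to θ (m , q))) ≡ true
      hits m with em {∃ λ q → c (inj₁ (to θ (m , q))) ≡ true}
      ... | yes hit = hit
      ... | no miss = contradiction (m , λ q eq → miss (q , eq)) somewhere

-- Recovering a linear order from its encoding

restrict-iso : ∀ {A A′ M M′} (φ : M ≅ M′) (i : Universe A → Universe M) (i′ : Universe A′ → Universe M′) →
  (∀ {x y} → i x ≡ i y → x ≡ y) → (∀ {x y} → i′ x ≡ i′ y → x ≡ y) →
  (∀ x y → R A x y ⇔ R M (i x) (i y)) → (∀ x y → R A′ x y ⇔ R M′ (i′ x) (i′ y)) →
  (∀ x → ∃ λ x′ → to φ (i x) ≡ i′ x′) → (∀ x′ → ∃ λ x → from φ (i′ x′) ≡ i x) → A ≅ A′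
restrict-iso {M′ = M′} φ i i′ i-injective i′-injective i-preserves i′-preserves onto onto⁻¹ = mk≅
  (λ x → proj₁ (onto x)) (λ x′ → proj₁ (onto⁻¹ x′))
  (λ x′ → i′-injective (trans (sym (proj₂ (onto (proj₁ (onto⁻¹ x′)))))
    (Iso.to-from (≅-sym φ) (proj₂ (onto⁻¹ x′)))))
  (λ x → i-injective (trans (sym (proj₂ (onto⁻¹ (proj₁ (onto x))))) (Iso.to-from φ (proj₂ (onto x)))))
  λ x y → ⇔.trans (i-preserves x y) (⇔.trans (Iso.preserves φ (i x) (i y))
    (⇔.trans (subst₂ (λ u v → R M′ (to φ (i x)) (to φ (i y)) ⇔ R M′ u v)
      (proj₂ (onto x)) (proj₂ (onto y)) ⇔.refl) (⇔.sym (i′-preserves _ _))))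

Bool-order : Structure
Bool-order = record { Universe = Bool ; R = Bool._<_ }

-- The two middle points mark where ℚ ends. Without such a mark, `L` empty and `L = ℚ` would give
-- isomorphic sums.
encodeOrder : Structure → Structure
encodeOrder L = ℚ-order ⊕ (Bool-order ⊕ L)

record Covers (M : Structure) (x y : Universe M) : Set where
  constructor _,_
  field
    related : R M x y
    minimal : ∀ z → R M x z → ¬ R M z y

covers-cong : ∀ {M N} (φ : M ≅ N) {x y} → Covers M x y → Covers N (to φ x) (to φ y)
covers-cong {M} {N} φ {x} {y} (x<y , none) = ⇒ (Iso.preserves φ x y) x<y , λ z φx<z z<φy →
  none (from φ z) (subst (λ u → R M u (from φ z)) (Iso.from∘to φ x) (⇒ (Iso.preserves (≅-sym φ) _ _) φx<z))
                  (subst (R M (from φ z)) (Iso.from∘to φ y) (⇒ (Iso.preserves (≅-sym φ) _ _) z<φy))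

covers-unique : ∀ {M} → IsLinearOrder M → ∀ {x y z} → Covers M x y → Covers M x z → y ≡ z
covers-unique lin {x} {y} {z} (x<y , noneʸ) (x<z , noneᶻ) with IsStrictTotalOrder.compare lin y z
... | tri< y<z _ _ = contradiction y<z (noneᶻ y x<y)
... | tri≈ _ y≡z _ = y≡z
... | tri> _ _ z<y = contradiction z<y (noneʸ z x<z)

-- The two middle points form the least covering pair of ℚ ⊕ 2 ⊕ L, which makes L definable.
module _ {L : Structure} where
  private
    M : Structure
    M = encodeOrder L

  first second : Universe M
  first  = inj₂ (inj₁ false)
  second = inj₂ (inj₁ true)

  tail : Universe L → Universe M
  tail l = inj₂ (inj₂ l)

  tail-injective : ∀ {x y} → tail x ≡ tail y → x ≡ y
  tail-injective refl = refl

  second-covers-first : Covers M first second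
  second-covers-first = Bool.f<t , λ
    { (inj₁ _) () _
    ; (inj₂ (inj₁ false)) () _
    ; (inj₂ (inj₁ true)) _ ()
    ; (inj₂ (inj₂ _)) _ () }

  -- Within ℚ density gives a point strictly between; for `y` beyond ℚ, `q + 1` is one.
  rational-uncovered : ∀ q y → ¬ Covers M (inj₁ q) y
  rational-uncovered q (inj₁ r) (q<r , none) = let s , q<s , s<r = ℚ.<-dense q<r in none (inj₁ s) q<s s<r
  rational-uncovered q (inj₂ _) (_ , none) = none (inj₁ (q ℚ.+ 1ℚ)) (q<q+1 q) tt

  first-least-covered : ∀ x {y} → Covers M x y → ¬ R M x first
  first-least-covered (inj₁ q) cov _ = rational-uncovered q _ cov
  first-least-covered (inj₂ (inj₁ _)) cov ()
  first-least-covered (inj₂ (inj₂ _)) cov ()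

  above-second : ∀ x → R M second x → ∃ λ l → x ≡ tail l
  above-second (inj₂ (inj₂ l)) _ = l , refl

encodeOrder-linear : ∀ {L} → IsLinearOrder L → IsLinearOrder (encodeOrder L)
encodeOrder-linear lin = ⊕-linear ℚ.<-isStrictTotalOrder (⊕-linear Bool.<-isStrictTotalOrder lin)

module _ {L L′ : Structure} (lin′ : IsLinearOrder L′) (φ : encodeOrder L ≅ encodeOrder L′) where
  private
    M M′ : Structure
    M = encodeOrder L
    M′ = encodeOrder L′

  -- `first` is the least point that has a cover. This is invariant under isomorphism, so `φ` rules
  -- out one strict inequality and its inverse the other.
  first-fixed : to φ (first {L}) ≡ first {L′}
  first-fixed with IsStrictTotalOrder.compare (encodeOrder-linear lin′) (to φ (first {L})) (first {L′})
  ... | tri< φf<f _ _ = contradiction φf<f (first-least-covered {L′} _ (covers-cong φ (second-covers-first {L})))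
  ... | tri≈ _ eq _ = eq
  ... | tri> _ _ f<φf = contradiction
    (subst (R M (from φ (first {L′}))) (Iso.from∘to φ (first {L})) (⇒ (Iso.preserves (≅-sym φ) _ _) f<φf))
    (first-least-covered {L} _ (covers-cong (≅-sym φ) (second-covers-first {L′})))

  second-fixed : to φ (second {L}) ≡ second {L′}
  second-fixed = covers-unique (encodeOrder-linear lin′)
    (subst (λ x → Covers M′ x (to φ (second {L}))) first-fixed (covers-cong φ (second-covers-first {L})))
    (second-covers-first {L′})

  tail-to-tail : ∀ l → ∃ λ l′ → to φ (tail {L} l) ≡ tail {L′} l′
  tail-to-tail l = above-second {L′} _
    (subst (λ x → R M′ x (to φ (tail {L} l))) second-fixed (⇒ (Iso.preserves φ (second {L}) (tail {L} l)) tt))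

encodeOrder-injective : ∀ {L L′} → IsLinearOrder L → IsLinearOrder L′ → encodeOrder L ≅ encodeOrder L′ → L ≅ L′
encodeOrder-injective {L} {L′} lin lin′ φ =
  restrict-iso φ (tail {L}) (tail {L′}) (tail-injective {L}) (tail-injective {L′}) (λ _ _ → ⇔.refl) (λ _ _ → ⇔.refl)
    (tail-to-tail {L} {L′} lin′ φ) (tail-to-tail {L′} {L} lin (≅-sym φ))

-- Graphs

-- `nil` and `cons` build a new vertex joined to a prescribed list of old
-- ones; the label of `nil` provides infinitely many such vertices.
data Free (V : Set) : Set where
  base : V → Free V
  nil  : ℕ → Free V
  cons : Free V → Free V → Free V

module _ {V : Set} where

  -- `cons` adds `x` to the list coded by `y`; here `y` is the tail and not itself a child.
  children : Free V → List (Free V)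
  children (base _)   = []
  children (nil _)    = []
  children (cons x y) = x ∷ children y

  label : Free V → ℕ
  label (base _)   = 0
  label (nil k)    = k
  label (cons _ y) = label y

  star : List (Free V) → ℕ → Free V
  star U k = foldr cons (nil k) U

  children-star : ∀ U k → children (star U k) ≡ U
  children-star [] k      = refl
  children-star (u ∷ U) k = cong (u ∷_) (children-star U k)

  label-star : ∀ U k → label (star U k) ≡ k
  label-star [] k      = refl
  label-star (_ ∷ U) k = label-star U k

  star≢base : ∀ U k v → star U k ≢ base v
  star≢base [] k v ()
  star≢base (_ ∷ _) k v ()

  size : Free V → ℕ
  size (base _)   = 0
  size (nil _)    = 0
  size (cons x y) = suc (size x ℕ.+ size y)

  -- Makes the child relation irreflexive, and with it the adjacency of the free graph.
  child-smaller : ∀ {x} y → x ∈ children y → size x < size y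
  child-smaller (cons x y) (here refl) = s≤s (ℕ.m≤m+n (size x) (size y))
  child-smaller (cons x y) (there p)   = ℕ.m<n⇒m<1+n (ℕ.<-≤-trans (child-smaller y p) (ℕ.m≤n+m (size y) (size x)))

  label-bound : (l : List (Free V)) → ∃ λ k → ∀ {x} → x ∈ l → label x < k
  label-bound [] = 0 , λ ()
  label-bound (x ∷ l) = let k , bound = label-bound l in suc (label x) ⊔ k , λ
    { (here refl) → ℕ.m≤m⊔n (suc (label x)) k
    ; (there p)   → ℕ.<-≤-trans (bound p) (ℕ.m≤n⊔m (suc (label x)) k) }

Free-countable : ∀ {V} → V ↣ ℕ → Free V ↣ ℕ
Free-countable {V} c = mk↣ {to = encode} (λ {x} {y} → inj x y)
  where
  encode : Free V → ℕ
  encode (base v)   = pair 0 (code c v)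
  encode (nil k)    = pair 1 k
  encode (cons x y) = pair 2 (pair (encode x) (encode y))

  inj : ∀ x y → encode x ≡ encode y → x ≡ y
  inj (base v) (base w) eq = cong base (code-injective c (proj₂ (pair-injective eq)))
  inj (nil k) (nil l) eq = cong nil (proj₂ (pair-injective eq))
  inj (cons x y) (cons x′ y′) eq =
    let eq₁ , eq₂ = pair-injective (proj₂ (pair-injective eq)) in cong₂ cons (inj x x′ eq₁) (inj y y′ eq₂)
  inj (base _) (nil _) eq = contradiction (proj₁ (pair-injective eq)) λ ()
  inj (base _) (cons _ _) eq = contradiction (proj₁ (pair-injective eq)) λ ()
  inj (nil _) (base _) eq = contradiction (proj₁ (pair-injective eq)) λ ()
  inj (nil _) (cons _ _) eq = contradiction (proj₁ (pair-injective eq)) λ ()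
  inj (cons _ _) (base _) eq = contradiction (proj₁ (pair-injective eq)) λ ()
  inj (cons _ _) (nil _) eq = contradiction (proj₁ (pair-injective eq)) λ ()

mapFree : ∀ {V W} → (V → W) → Free V → Free W
mapFree f (base v)   = base (f v)
mapFree f (nil k)    = nil k
mapFree f (cons x y) = cons (mapFree f x) (mapFree f y)

mapFree-inverse : ∀ {V W} (f : V → W) (g : W → V) → (∀ w → f (g w) ≡ w) → ∀ x → mapFree f (mapFree g x) ≡ x
mapFree-inverse f g f∘g (base w)   = cong base (f∘g w)
mapFree-inverse f g f∘g (nil k)    = refl
mapFree-inverse f g f∘g (cons x y) = cong₂ cons (mapFree-inverse f g f∘g x) (mapFree-inverse f g f∘g y)

children-mapFree : ∀ {V W} (f : V → W) x → children (mapFree f x) ≡ map (mapFree f) (children x)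
children-mapFree f (base _)   = refl
children-mapFree f (nil _)    = refl
children-mapFree f (cons x y) = cong (mapFree f x ∷_) (children-mapFree f y)

data Adjacent (X : Structure) : Free (Universe X) → Free (Universe X) → Set where
  edge : ∀ {v w} → R X v w → Adjacent X (base v) (base w)
  down : ∀ {x y} → y ∈ children x → Adjacent X x y
  up   : ∀ {x y} → x ∈ children y → Adjacent X x y

FreeGraph : Structure → Structure
FreeGraph X = record { Universe = Free (Universe X) ; R = Adjacent X }

FreeGraph-isGraph : ∀ {X} → IsGraph X → IsGraph (FreeGraph X)
FreeGraph-isGraph {X} (irr , symm) = irreflexive , symmetric
  where
  irreflexive : Irreflexive _≡_ (Adjacent X)
  irreflexive refl (edge r)     = irr refl r
  irreflexive refl (down {x} p) = ℕ.<-irrefl refl (child-smaller x p)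
  irreflexive refl (up {x} p)   = ℕ.<-irrefl refl (child-smaller x p)

  symmetric : Symmetric (Adjacent X)
  symmetric (edge r) = edge (symm r)
  symmetric (down p) = up p
  symmetric (up p)   = down p

base-preserves : ∀ {X} v w → R X v w ⇔ Adjacent X (base v) (base w)
base-preserves {X} v w = mk⇔ edge λ { (edge r) → r }

mapFree-adjacent : ∀ {X Y} (φ : X ≅ Y) {x y} → Adjacent X x y → Adjacent Y (mapFree (to φ) x) (mapFree (to φ) y)
mapFree-adjacent φ (edge r) = edge (⇒ (Iso.preserves φ _ _) r)
mapFree-adjacent φ (down {x} p) =
  down (subst (_ ∈_) (sym (children-mapFree (to φ) x)) (∈-map⁺ (mapFree (to φ)) p))
mapFree-adjacent φ (up {y = y} p) =
  up (subst (_ ∈_) (sym (children-mapFree (to φ) y)) (∈-map⁺ (mapFree (to φ)) p))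

-- Renaming base vertices commutes with taking children, so isomorphisms of the base graphs extend
-- canonically.
FreeGraph-cong : ∀ {X Y} → X ≅ Y → FreeGraph X ≅ FreeGraph Y
FreeGraph-cong {X} {Y} φ = mk≅ (mapFree (to φ)) (mapFree (from φ)) (mapFree-inverse _ _ (Iso.to∘from φ)) inv
  λ x y → mk⇔ (mapFree-adjacent φ)
    (λ r → subst₂ (Adjacent X) (inv x) (inv y) (mapFree-adjacent (≅-sym φ) r))
  where
  inv : ∀ x → mapFree (from φ) (mapFree (to φ) x) ≡ x
  inv = mapFree-inverse _ _ (Iso.from∘to φ)

-- `z` realises a finite type over `U` and `W`. Distinctness from `U` comes from irreflexivity;
-- distinctness from `W` has to be stated.
Extends : (A : Structure) (U W : List (Universe A)) → Universe A → Set
Extends A U W z = (∀ {u} → u ∈ U → R A z u) × (∀ {w} → w ∈ W → z ≢ w × ¬ R A z w)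

-- The children of `z` are exactly `U`, and its label `k` exceeds all labels in `W` and among the
-- children of `W`. Hence `z` is neither in `W` nor a child of a vertex of `W`, and disjointness
-- keeps `W` away from its own children.
extend-free : ∀ X U W → Disjoint U W → ∃ λ z → Extends (FreeGraph X) U W z × (∀ v → z ≢ base v)
extend-free X U W disjoint = z , ((λ u∈U → down (subst (_ ∈_) (sym (children-star U k)) u∈U)) ,
                                  (λ w∈W → z≢w w∈W , nonadjacent w∈W)) , star≢base U k
  where
  old : List (Free (Universe X))
  old = W ++ concatMap children W

  k : ℕ
  k = proj₁ (label-bound old)

  z : Free (Universe X)
  z = star U k

  z∉old : ¬ z ∈ old
  z∉old z∈old = ℕ.<-irrefl (label-star U k) (proj₂ (label-bound old) z∈old)

  z≢w : ∀ {w} → w ∈ W → z ≢ w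
  z≢w w∈W refl = z∉old (∈-++⁺ˡ w∈W)

  -- Stated for a variable `y` because `star U k` is not a constructor form.
  star-adjacent : ∀ {y w} → y ≡ z → Adjacent X y w → w ∈ U ⊎ y ∈ children w
  star-adjacent y≡z (edge {v} _) = contradiction (sym y≡z) (star≢base U k v)
  star-adjacent refl (down p)    = inj₁ (subst (_ ∈_) (children-star U k) p)
  star-adjacent y≡z (up p)       = inj₂ p

  nonadjacent : ∀ {w} → w ∈ W → ¬ Adjacent X z w
  nonadjacent w∈W r with star-adjacent refl r
  ... | inj₁ w∈U = disjoint (w∈U , w∈W)
  ... | inj₂ z∈w = z∉old (∈-++⁺ʳ W (∈-concatMap⁺ children (Any.map (λ { refl → z∈w }) w∈W)))

module _ (em : ExcludedMiddle 0ℓ) {A B : Structure} (graphA : IsGraph A) (graphB : IsGraph B)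
         {I : Set} (f : I → Universe A) (g : I → Universe B) {l : List I} (comp : Compatible A B f g l)
         (a : Universe A) where
  private
    adjacent? : ∀ i → Dec (R A a (f i))
    adjacent? i = em

    nonadjacent? : ∀ i → Dec (¬ R A a (f i))
    nonadjacent? i = ¬? em

  neighbours nonneighbours : List (Universe B)
  neighbours    = map g (filter adjacent? l)
  nonneighbours = map g (filter nonadjacent? l)

  ∈-neighbours : ∀ {i} → i ∈ l → R A a (f i) → g i ∈ neighbours
  ∈-neighbours i∈l r = ∈-map∘filter⁺ g adjacent? (_ , i∈l , refl , r)

  ∈-nonneighbours : ∀ {i} → i ∈ l → ¬ R A a (f i) → g i ∈ nonneighbours
  ∈-nonneighbours i∈l r = ∈-map∘filter⁺ g nonadjacent? (_ , i∈l , refl , r)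

  -- If `g i` and `g j` agree, compatibility makes `f i` and `f j` agree, so `a` cannot be adjacent
  -- to just one of them.
  neighbours-disjoint : Disjoint neighbours nonneighbours
  neighbours-disjoint (p , q) with ∈-map∘filter⁻ g adjacent? p | ∈-map∘filter⁻ g nonadjacent? q
  ... | i , i∈l , eq , r | j , j∈l , eq′ , ¬r =
    ¬r (subst (R A a) (⇐ (proj₁ (comp i∈l j∈l)) (trans (sym eq) eq′)) r)

  extends-fits : ∀ {b} → Extends B neighbours nonneighbours b → Fresh A B f g l a → Fits A B f g l a b
  extends-fits {b} (adj , nonadj) fresh {i} i∈l with em {R A a (f i)}
  ... | yes r = let s = adj (∈-neighbours i∈l r) in
    (λ eq → proj₁ graphB eq s) ,
    mk⇔ (λ _ → s) (λ _ → r) , mk⇔ (λ _ → proj₂ graphB s) (λ _ → proj₂ graphA r)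
  ... | no ¬r = let b≢ , ¬s = nonadj (∈-nonneighbours i∈l ¬r) in
    b≢ , mk⇔ (λ r → contradiction r ¬r) (λ s → contradiction s ¬s) ,
    mk⇔ (λ r → contradiction (proj₂ graphA r) ¬r) (λ s → contradiction (proj₂ graphB s) ¬s)

-- The Rado graph and its colourings

Empty : Structure
Empty = record { Universe = ⊥ ; R = λ () }

-- By `extend-free` this countable graph realises every finite type, which characterises the Rado
-- graph.
Rado : Structure
Rado = FreeGraph Empty

Rado-isGraph : IsGraph Rado
Rado-isGraph = FreeGraph-isGraph ((λ { {()} }) , λ { {()} })

Rado-countable : Countable Rado
Rado-countable = Free-countable (mk↣ {to = λ ()} λ { {()} })

-- A base type is unavoidable: if vertices are coloured by adjacency to a fixed vertex, neither
-- colour realises all types.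
record RelativelyGeneric (c : Universe Rado → Bool) : Set where
  field
    colour   : Bool
    U₀ W₀    : List (Universe Rado)
    disjoint : Disjoint U₀ W₀
    extends  : ∀ {U W} → Disjoint U W → U₀ ⊆ U → W₀ ⊆ W → ∃ λ z → Extends Rado U W z × c z ≡ colour

-- If `true` omits some type, that type is the base: its extensions are realised by `extend-free`,
-- necessarily in colour `false`. If it omits none, the empty base works.
relatively-generic : ExcludedMiddle 0ℓ → ∀ c → RelativelyGeneric c
relatively-generic em c
  with em {∃ λ U → ∃ λ W → Disjoint U W × (∀ z → Extends Rado U W z → c z ≢ true)}
... | yes (U₀ , W₀ , disj , never) = record
  { colour = false ; U₀ = U₀ ; W₀ = W₀ ; disjoint = disj
  ; extends = λ {U} {W} d U₀⊆U W₀⊆W → let z , ext , _ = extend-free Empty U W d in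
      z , ext , ¬-not (never z ((λ p → proj₁ ext (U₀⊆U p)) , λ p → proj₂ ext (W₀⊆W p)))
  }
... | no ¬never = record
  { colour = true ; U₀ = [] ; W₀ = [] ; disjoint = λ { (() , _) }
  ; extends = λ {U} {W} d _ _ → hits U W d
  }
  where
  hits : ∀ U W → Disjoint U W → ∃ λ z → Extends Rado U W z × c z ≡ true
  hits U W d with em {∃ λ z → Extends Rado U W z × c z ≡ true}
  ... | yes hit = hit
  ... | no miss = contradiction (U , W , d , λ z ext eq → miss (z , ext , eq)) ¬never

-- M is placed over U₀ and W₀ so that all of it lands in the generic colour.
module Placement (em : ExcludedMiddle 0ℓ) {M : Structure} (cM : Countable M) (graphM : IsGraph M)
                 (c : Universe Rado → Bool) (generic : RelativelyGeneric c) where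
  open RelativelyGeneric generic

  -- The summand `Rado` supplies vertices of `F` corresponding to `U₀` and `W₀`. Its joins to `M` do
  -- not distinguish vertices of `M`, so automorphisms of `M` extend to `X`.
  X : Structure
  X = Sum M Rado (_∈ U₀) (_∈ U₀)

  X-isGraph : IsGraph X
  X-isGraph = (λ {x} → irreflexive x) , λ {x} {y} → symmetric x y
    where
    irreflexive : ∀ x {y} → x ≡ y → ¬ R X x y
    irreflexive (inj₁ x) refl r = proj₁ graphM refl r
    irreflexive (inj₂ x) refl r = proj₁ Rado-isGraph refl r

    symmetric : ∀ x y → R X x y → R X y x
    symmetric (inj₁ x) (inj₁ y) r = proj₂ graphM r
    symmetric (inj₁ x) (inj₂ y) r = r
    symmetric (inj₂ x) (inj₁ y) r = r
    symmetric (inj₂ x) (inj₂ y) r = proj₂ Rado-isGraph r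

  F : Structure
  F = FreeGraph X

  F-isGraph : IsGraph F
  F-isGraph = FreeGraph-isGraph X-isGraph

  point : Universe M → Universe F
  point m = base (inj₁ m)

  fixed : Universe Rado → Universe F × Universe Rado
  fixed r = base (inj₂ r) , r

  l₀ : List (Universe F × Universe Rado)
  l₀ = map fixed (U₀ ++ W₀)

  Coloured : Universe F × Universe Rado → Set
  Coloured (x , r) = ∀ m → x ≡ point m → c r ≡ colour

  -- Keeping `l₀` in the list ensures that the type of a new point of `M` over the list extends
  -- `U₀`, `W₀`, as `extends` requires.
  record Good (l : List (Universe F × Universe Rado)) : Set where
    field
      contains   : l₀ ⊆ l
      compatible : Compatible F Rado proj₁ proj₂ l
      coloured   : ∀ {p} → p ∈ l → Coloured p
  open Good

  good-∈ : ∀ {l p} → Good l → p ∈ l → Good (p ∷ l)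
  good-∈ good p∈l = record
    { contains   = there ∘ contains good
    ; compatible = compatible-⊆ {F} {Rado} (∈⇒∷-⊆ p∈l) (compatible good)
    ; coloured   = coloured good ∘ ∈⇒∷-⊆ p∈l
    }

  good-∷ : ∀ {l p} → Good l → Compatible F Rado proj₁ proj₂ (p ∷ l) → Coloured p → Good (p ∷ l)
  good-∷ good comp col = record
    { contains   = there ∘ contains good
    ; compatible = comp
    ; coloured   = λ { (here refl) → col ; (there q) → coloured good q }
    }

  -- Both sides carry the graph that `Rado` induces on `U₀ ++ W₀`, and no vertex of `M` occurs, so
  -- the colour condition is vacuous.
  good₀ : Good l₀
  good₀ = record
    { contains   = id
    ; compatible = compat
    ; coloured   = λ p∈l₀ → col (∈-map⁻ fixed p∈l₀)
    }
    where
    compat : Compatible F Rado proj₁ proj₂ l₀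
    compat p∈ q∈ with ∈-map⁻ fixed p∈ | ∈-map⁻ fixed q∈
    ... | r , _ , refl | s , _ , refl =
      mk⇔ (λ { refl → refl }) (λ { refl → refl }) , ⇔.sym (base-preserves {X} (inj₂ r) (inj₂ s))

    col : ∀ {p} → (∃ λ r → r ∈ U₀ ++ W₀ × p ≡ fixed r) → Coloured p
    col (_ , _ , refl) m ()

  fixed-U₀ : ∀ {l u} → Good l → u ∈ U₀ → fixed u ∈ l
  fixed-U₀ good p = contains good (∈-map⁺ fixed (∈-++⁺ˡ p))

  fixed-W₀ : ∀ {l w} → Good l → w ∈ W₀ → fixed w ∈ l
  fixed-W₀ good p = contains good (∈-map⁺ fixed (∈-++⁺ʳ U₀ p))

  module _ {l} (good : Good l) (x : Universe F) where
    private
      U W : List (Universe Rado)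
      U = neighbours em F-isGraph Rado-isGraph proj₁ proj₂ (compatible good) x
      W = nonneighbours em F-isGraph Rado-isGraph proj₁ proj₂ (compatible good) x

      U∩W≡∅ : Disjoint U W
      U∩W≡∅ = neighbours-disjoint em F-isGraph Rado-isGraph proj₁ proj₂ (compatible good) x

    coloured-extension : ∃ λ z → Extends Rado U W z × Coloured (x , z)
    coloured-extension with em {∃ λ m → x ≡ point m}
    ... | no ¬point = let z , ext , _ = extend-free Empty U W U∩W≡∅ in
      z , ext , λ m eq → contradiction (m , eq) ¬point
    ... | yes (m , refl) = let z , ext , cz = extends U∩W≡∅ U₀⊆U W₀⊆W in z , ext , λ _ _ → cz
      where
      U₀⊆U : U₀ ⊆ U
      U₀⊆U u∈U₀ = ∈-neighbours em F-isGraph Rado-isGraph proj₁ proj₂ (compatible good) x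
        (fixed-U₀ good u∈U₀) (edge u∈U₀)

      W₀⊆W : W₀ ⊆ W
      W₀⊆W w∈W₀ = ∈-nonneighbours em F-isGraph Rado-isGraph proj₁ proj₂ (compatible good) x
        -- Base vertices have no children, so only an edge of `X` could join `x` to the vertex of
        -- `w`, and that would put `w` in `U₀`.
        (fixed-W₀ good w∈W₀) λ { (edge w∈U₀) → disjoint (w∈U₀ , w∈W₀) }

    forth : ∃ λ r → Good ((x , r) ∷ l)
    forth with occurs? em proj₁ l x
    ... | inj₁ ((_ , r) , p∈l , refl) = r , good-∈ good p∈l
    ... | inj₂ fresh = let z , ext , col = coloured-extension in z , good-∷ good
      (compatible-∷ {F} {Rado} (proj₁ F-isGraph) (proj₁ Rado-isGraph) (compatible good) fresh
        (extends-fits em F-isGraph Rado-isGraph proj₁ proj₂ (compatible good) x ext fresh))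
      col

  back : ∀ {l} → Good l → ∀ r → ∃ λ x → Good ((x , r) ∷ l)
  back {l} good r with occurs? em proj₂ l r
  ... | inj₁ ((x , _) , p∈l , refl) = x , good-∈ good p∈l
  ... | inj₂ fresh =
    let z , ext , z≢base = extend-free X _ _ (neighbours-disjoint em Rado-isGraph F-isGraph proj₂ proj₁ comp r) in
    z , good-∷ good
      (compatible-sym {Rado} {F} (compatible-∷ {Rado} {F} (proj₁ Rado-isGraph) (proj₁ F-isGraph) comp fresh
        (extends-fits em Rado-isGraph F-isGraph proj₂ proj₁ comp r ext fresh)))
      -- The new vertex is not a base vertex, so it is no point of `M` and `r` may have either
      -- colour.
      λ m eq → contradiction eq (z≢base (inj₁ m))
    where
    comp : Compatible Rado F proj₂ proj₁ l
    comp = compatible-sym {F} {Rado} (compatible good)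

  module Construction = BackAndForth em {F} {Rado}
    (Free-countable (⊎-countable cM Rado-countable)) Rado-countable Good compatible forth back (l₀ , good₀)

  θ : F ≅ Rado
  θ = Construction.isomorphism

  θ-coloured : ∀ m → c (to θ (point m)) ≡ colour
  θ-coloured m = let _ , good , p∈l = Construction.isomorphism-good (point m) in coloured good p∈l m refl

-- Encoding graphs and recovering them

encodeGraph : Structure → Structure
encodeGraph G = Sum Rado G (λ _ → ⊥) (λ _ → ⊥)

encodeGraph-countable : ∀ {G} → Countable G → Countable (encodeGraph G)
encodeGraph-countable = ⊎-countable Rado-countable

module _ {G : Structure} (cG : Countable G) (graphG : IsGraph G) where

  encodeGraph-isGraph : IsGraph (encodeGraph G)
  encodeGraph-isGraph = (λ {x} → irreflexive x) , λ {x} {y} → symmetric x y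
    where
    irreflexive : ∀ x {y} → x ≡ y → ¬ R (encodeGraph G) x y
    irreflexive (inj₁ x) refl r = proj₁ Rado-isGraph refl r
    irreflexive (inj₂ x) refl r = proj₁ graphG refl r

    symmetric : ∀ x y → R (encodeGraph G) x y → R (encodeGraph G) y x
    symmetric (inj₁ x) (inj₁ y) r = proj₂ Rado-isGraph r
    symmetric (inj₂ x) (inj₂ y) r = proj₂ graphG r

  encodeGraph-indivisible : ExcludedMiddle 0ℓ → SymmetricallyIndivisible (encodeGraph G)
  encodeGraph-indivisible em = indivisible-from-copies em (encodeGraph G) λ c → copy c (relatively-generic em (c ∘ inj₁))
    where
    copy : ∀ c → RelativelyGeneric (c ∘ inj₁) → MonochromaticCopy em (encodeGraph G) c
    copy c generic = record
      { embed = λ m → inj₁ (to θ (point m))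
      ; embed-injective = λ eq → point-injective (Iso.to-injective θ (inj₁-injective eq))
      ; preserves = λ x y → ⇔.trans (base-preserves {X} (inj₁ x) (inj₁ y)) (Iso.preserves θ (point x) (point y))
      ; colour = RelativelyGeneric.colour generic
      ; monochromatic = θ-coloured
      -- `σ` is extended to `X` by the identity, to `F` by functoriality, to `Rado` along `θ`, and
      -- to the encoding by the identity on `G`.
      ; extend = λ σ → extend-left (≅-trans (≅-sym θ) (≅-trans (FreeGraph-cong (extend-left σ)) θ)) , λ m →
          cong (λ x → inj₁ (to θ (to (FreeGraph-cong (extend-left {encodeGraph G} {Rado} {_∈ U₀} {_∈ U₀} σ)) x)))
            (Iso.from∘to θ (point m))
      }
      where
      open Placement em (encodeGraph-countable {G} cG) encodeGraph-isGraph (c ∘ inj₁) generic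
      open RelativelyGeneric generic using (U₀)

      point-injective : ∀ {x y} → point x ≡ point y → x ≡ y
      point-injective refl = refl

-- Connectedness of `Rado`, by paths of length two.
common-neighbour : ∀ x y → ∃ λ z → Adjacent Empty z x × Adjacent Empty z y
common-neighbour x y = let z , (adj , _) , _ = extend-free Empty (x ∷ y ∷ []) [] λ { (_ , ()) } in
  z , adj (here refl) , adj (there (here refl))

InRado : ∀ {G} → Universe (encodeGraph G) → Set
InRado x = ∃ λ r → x ≡ inj₁ r

inRado-adjacent : ∀ {G x y} → R (encodeGraph G) x y → InRado {G} x → InRado {G} y
inRado-adjacent {y = inj₁ s} _ _ = s , refl
inRado-adjacent {y = inj₂ _} () (_ , refl)

-- No edge leaves the summand `Rado`, so the image of a path from `r` to `s` stays in it once it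
-- starts there.
rado-to-rado : ∀ {G H} (φ : encodeGraph G ≅ encodeGraph H) r s →
               InRado {H} (to φ (inj₁ r)) → InRado {H} (to φ (inj₁ s))
rado-to-rado {G} {H} φ r s r-in = let z , zr , zs = common-neighbour r s in
  inRado-adjacent {H} (⇒ (Iso.preserves φ (inj₁ z) (inj₁ s)) zs)
    (inRado-adjacent {H} (⇒ (Iso.preserves φ (inj₁ r) (inj₁ z)) (proj₂ Rado-isGraph {z} {r} zr)) r-in)

-- Rado is connected, so an isomorphism either matches the two copies of it
-- or moves each of them into the other graph; in the latter case a vertex
-- sent into Rado is brought out of it by a second application.
Transfers : ∀ {G H} → encodeGraph G ≅ encodeGraph H → Universe G → Universe H → Set
Transfers φ g h = to φ (inj₂ g) ≡ inj₂ h ⊎ (∃ λ r → to φ (inj₂ g) ≡ inj₁ r × to φ (inj₁ r) ≡ inj₂ h)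

module _ {G H : Structure} (φ : encodeGraph G ≅ encodeGraph H) where

  transfers-sym : ∀ {g h} → Transfers φ g h → Transfers (≅-sym φ) h g
  transfers-sym (inj₁ eq)            = inj₁ (Iso.to-from φ eq)
  transfers-sym (inj₂ (r , eq , eq′)) = inj₂ (r , Iso.to-from φ eq′ , Iso.to-from φ eq)

  transfers-unique : ∀ {g h h′} → Transfers φ g h → Transfers φ g h′ → h ≡ h′
  transfers-unique (inj₁ p) (inj₁ q) = inj₂-injective (trans (sym p) q)
  transfers-unique (inj₁ p) (inj₂ (_ , q , _)) = contradiction (trans (sym p) q) λ ()
  transfers-unique (inj₂ (_ , p , _)) (inj₁ q) = contradiction (trans (sym p) q) λ ()
  transfers-unique (inj₂ (r , p , p′)) (inj₂ (s , q , q′)) =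
    inj₂-injective (trans (sym p′) (trans (cong (to φ ∘ inj₁) (inj₁-injective (trans (sym p) q))) q′))

  transfers-preserves : ∀ {g g′ h h′} → Transfers φ g h → Transfers φ g′ h′ → R G g g′ → R H h h′
  transfers-preserves {g} {g′} (inj₁ p) (inj₁ q) e =
    subst₂ (R (encodeGraph H)) p q (⇒ (Iso.preserves φ (inj₂ g) (inj₂ g′)) e)
  -- The mixed cases are impossible: the edge would be sent to vertices in different summands.
  transfers-preserves {g} {g′} (inj₁ p) (inj₂ (_ , q , _)) e =
    ⊥-elim (subst₂ (R (encodeGraph H)) p q (⇒ (Iso.preserves φ (inj₂ g) (inj₂ g′)) e))
  transfers-preserves {g} {g′} (inj₂ (_ , p , _)) (inj₁ q) e =
    ⊥-elim (subst₂ (R (encodeGraph H)) p q (⇒ (Iso.preserves φ (inj₂ g) (inj₂ g′)) e))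
  transfers-preserves {g} {g′} (inj₂ (r , p , p′)) (inj₂ (s , q , q′)) e =
    subst₂ (R (encodeGraph H)) p′ q′ (⇒ (Iso.preserves φ (inj₁ r) (inj₁ s))
      (subst₂ (R (encodeGraph H)) p q (⇒ (Iso.preserves φ (inj₂ g) (inj₂ g′)) e)))

  transfer : ∀ g → ∃ (Transfers φ g)
  transfer g with to φ (inj₂ g) in eq
  ... | inj₂ h = h , inj₁ refl
  ... | inj₁ r with to φ (inj₁ r) in eq′
  ... | inj₂ h = h , inj₂ (r , refl , eq′)
  -- If `r` were also sent into `Rado`, to `s`, the inverse would send `s` into `Rado` and hence `r`
  -- too, yet it sends `r` to `g`.
  ... | inj₁ s with rado-to-rado (≅-sym φ) s r (r , Iso.to-from φ eq′)
  ... | _ , out = contradiction (trans (sym (Iso.to-from φ eq)) out) λ ()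

-- `Transfers` is single-valued and passes to the inverse isomorphism, so the choices made in the
-- two directions are mutually inverse.
encodeGraph-injective : ∀ {G H} → encodeGraph G ≅ encodeGraph H → G ≅ H
encodeGraph-injective {G} {H} φ = mk≅ (λ g → proj₁ (there′ g)) (λ h → proj₁ (back′ h))
  (λ h → transfers-unique φ (proj₂ (there′ _)) (transfers-sym (≅-sym φ) (proj₂ (back′ h))))
  (λ g → transfers-unique (≅-sym φ) (proj₂ (back′ _)) (transfers-sym φ (proj₂ (there′ g))))
  λ g g′ → mk⇔ (transfers-preserves φ (proj₂ (there′ g)) (proj₂ (there′ g′)))
    (transfers-preserves (≅-sym φ) (transfers-sym φ (proj₂ (there′ g))) (transfers-sym φ (proj₂ (there′ g′))))
  where
  there′ : ∀ g → ∃ (Transfers φ g)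
  there′ = transfer φ

  back′ : ∀ h → ∃ (Transfers (≅-sym φ) h)
  back′ = transfer (≅-sym φ)

Bool-countable : Bool ↣ ℕ
Bool-countable = mk↣ {to = λ b → if b then 1 else 0}
  λ { {false} {false} _ → refl ; {true} {true} _ → refl }

corollary2p15 : ExcludedMiddle 0ℓ →
    Injection (IsoClasses (Countable ∩ IsGraph))
    (IsoClasses (Countable ∩ SymmetricallyIndivisible ∩ IsGraph))
    × Injection (IsoClasses (Countable ∩ IsLinearOrder))
    (IsoClasses (Countable ∩ SymmetricallyIndivisible ∩ IsLinearOrder))
corollary2p15 em = graphs , orders
  where
  graphs : Injection (IsoClasses (Countable ∩ IsGraph))
                     (IsoClasses (Countable ∩ SymmetricallyIndivisible ∩ IsGraph))
  graphs = record
    { to = λ (G , cG , graphG) → encodeGraph G ,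
        encodeGraph-countable {G} cG , encodeGraph-indivisible cG graphG em , encodeGraph-isGraph cG graphG
    ; cong = λ φ → sum-cong ≅-refl φ (λ _ → ⇔.refl) (λ _ → ⇔.refl)
    ; injective = encodeGraph-injective
    }

  orders : Injection (IsoClasses (Countable ∩ IsLinearOrder))
                     (IsoClasses (Countable ∩ SymmetricallyIndivisible ∩ IsLinearOrder))
  orders = record
    { to = λ (L , cL , linL) →
        -- The two marking points and `L` together form the right summand `N` of ℚ ⊕ N.
        let cN = ⊎-countable Bool-countable cL ; linN = ⊕-linear Bool.<-isStrictTotalOrder linL in
        encodeOrder L , ℚ⊕-countable em cN linN , ℚ⊕-indivisible em cN linN , encodeOrder-linear linL
    ; cong = λ φ → sum-cong ≅-refl (sum-cong ≅-refl φ (λ _ → ⇔.refl) (λ _ → ⇔.refl)) (λ _ → ⇔.refl) (λ _ → ⇔.refl)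
    ; injective = λ { {_ , _ , linL} {_ , _ , linL′} → encodeOrder-injective linL linL′ }
    }
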